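{- Linear $\mathrm{HTA}_\pm$ and $\mathrm{CTL}_\pm$ are equivalent formalisms: for every linear $\mathrm{HTA}_\pm$ $\mathcal{A}$ over $\Sigma=2^{AP}$ there is a $\mathrm{CTL}_\pm$ formula $\varphi$ with $\mathcal{L}(\mathcal{A})=\mathcal{L}(\varphi)$, and for every $\mathrm{CTL}_\pm$ formula $\varphi$ over $AP$ there is a linear $\mathrm{HTA}_\pm$ $\mathcal{A}$ with $\mathcal{L}(\mathcal{A})=\mathcal{L}(\varphi)$.
   Context: Fix a finite set $AP$, $\Sigma=2^{AP}$; $\Sigma$-trees are unranked (finitely many children per node), unordered, leafless trees labelled by $\Sigma$. $\mathrm{CTL}_\pm$: $\varphi ::= p\mid\neg\varphi\mid\varphi\lor\varphi\mid\mathsf{D}^n\varphi\mid\mathsf{E}\mathsf{X}\varphi\mid\mathsf{E}(\varphi\,\mathsf{U}\,\varphi)$, evaluated at node $u$: $p$ iff $p\in t(u)$; Booleans usual; $\mathsf{D}^n\varphi$ iff $u$ has at least $n$ distinct children satisfying $\varphi$; $\mathsf{E}\mathsf{X}\varphi$ iff some child of $u$ satisfies $\varphi$; $\mathsf{E}(\varphi_1\mathsf{U}\varphi_2)$ iff some downward path $u=v_0,\dots,v_j$ has $v_j\models\varphi_2$ and $v_k\models\varphi_1$ for $k<j$. $\mathcal{L}(\varphi)$: trees whose root satisfies $\varphi$. An $\mathrm{HTA}_\pm$ is $\mathcal{A}=\langle Q,\Sigma,\delta,q_I,F\rangle$, $Q$ finite, $q_I\in Q$, $F\subseteq Q$, $\delta:Q\times\Sigma\to\mathcal{B}^+(\{\Diamond_k,\Box_k\}_{k\in\mathbb{N}}\times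 Q)$ (positive Boolean formulae with $\top,\bot,\land,\lor$ over atoms; $\Diamond=\Diamond_1$, $\Box=\Box_1$). A run on $t$ from $s$: tree $r$ labelled in $Q\times\mathrm{Dom}(t)$, root $(q_I,s)$, each node $x$ labelled $(q,v)$ satisfies $\delta(q,t(v))$ where $x\models(\Diamond_k,q')$ iff $x$ has children labelled $(q',v_1),\dots,(q',v_k)$ for pairwise distinct children $v_i$ of $v$, and $x\models(\Box_k,q')$ iff for all but at most $k-1$ children $v'$ of $v$ some child of $x$ is labelled $(q',v')$. Accepting: every infinite path of $r$ from its root has infinitely many nodes with state in $F$. $\mathcal{L}(\mathcal{A})$: trees with an accepting run from the root. Hesitant: $Q$ partitioned into nonempty components $Q_1,\dots,Q_n$, totally ordered so that if $q\in Q_i$, $q'\in Q_j$ and $q'$ occurs in $\delta(q,\sigma)$ then $j\le i$, each component being exactly one of: transient (no atom with state in $Q_i$ occurs in $\delta(q,\sigma)$, $q\in Q_i$); existential (such $Q_i$-atoms all of form $(\Diamond,q')$, at most one in each clause of the DNF of $\delta(q,\sigma)$); universal (all of form $(\Box,q')$, at most one in each clause of the CNF). Polarised: states of existential components are not in $F$, states of universal components are in $F$. Linear: every component is a singleton.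
   Formalization: The finite set AP is assumed nonempty: for empty AP the grammar of CTL± generates no formula, so no linear HTA± could have an equivalent formula. -}

module Defs where

open import Level using (0ℓ)
open import Data.Nat using (ℕ; zero; suc; _≤_; _<_)
open import Data.Fin using (Fin; toℕ)
import Data.Fin as Fin
open import Data.Fin.Subset using (Subset; _∈_; _∉_; ∣_∣)
open import Data.List using (List; []; _∷_; _++_; cartesianProductWith)
import Data.List.Membership.Propositional as List
open import Data.Product using (Σ-syntax; ∃-syntax; _×_; _,_; proj₁; proj₂)
open import Data.Sum using (_⊎_)
open import Data.Unit using () renaming (⊤ to Unit)
open import Data.Empty using () renaming (⊥ to Empty)
open import Function.Definitions using (Injective; StrictlySurjective)
open import Relation.Binary.PropositionalEquality using (_≡_; _≢_)
open import Relation.Nullary using (¬_)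
open import Relation.Unary using (Pred)

-- A finitely branching tree is presented by the number of
-- children at each address, an address being a word over ℕ (last letter
-- first).  Only addresses of nodes matter: the value of `arity` elsewhere is
-- never looked at.  The children of a node u are exactly the pairwise distinct
-- nodes u · i.

mutual
  data Node (arity : List ℕ → ℕ) : Set where
    ε   : Node arity
    _·_ : (u : Node arity) → Fin (arity (addr u)) → Node arity

  addr : {arity : List ℕ → ℕ} → Node arity → List ℕ
  addr ε       = []
  addr (u · i) = toℕ i ∷ addr u

infixl 20 _·_

-- Leaves are allowed here: runs may have them.
record Tree (L : Set) : Set where
  field
    arity : List ℕ → ℕ
    label : Node arity → L

  Dom : Set
  Dom = Node arity

  #children : Dom → ℕ
  #children u = arity (addr u)

  _⋖_ : Dom → Dom → Set
  u ⋖ v = Σ[ i ∈ Fin (#children u) ] v ≡ u · i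

-- AP = Fin a and Σ = 2^AP = Subset a.
record ΣTree (a : ℕ) : Set where
  field
    tree : Tree (Subset a)
  open Tree tree public
  field
    leafless : (u : Dom) → 0 < #children u

data CTL± (a : ℕ) : Set where
  var : Fin a → CTL± a
  neg : CTL± a → CTL± a
  or  : CTL± a → CTL± a → CTL± a
  D   : ℕ → CTL± a → CTL± a
  EX  : CTL± a → CTL± a
  EU  : CTL± a → CTL± a → CTL± a

module _ {a : ℕ} (t : ΣTree a) where
  open ΣTree t

  -- In the EU clause only the values v 0 , … , v j form the path.
  infix 4 _⊨_
  _⊨_ : Dom → CTL± a → Set
  u ⊨ var p  = p ∈ label u
  u ⊨ neg φ  = ¬ (u ⊨ φ)
  u ⊨ or φ ψ = (u ⊨ φ) ⊎ (u ⊨ ψ)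
  u ⊨ D n φ  = Σ[ f ∈ (Fin n → Fin (#children u)) ]
                 Injective _≡_ _≡_ f × (∀ i → u · f i ⊨ φ)
  u ⊨ EX φ   = Σ[ i ∈ Fin (#children u) ] (u · i ⊨ φ)
  u ⊨ EU φ ψ = Σ[ j ∈ ℕ ] Σ[ v ∈ (ℕ → Dom) ]
                 v 0 ≡ u
               × (∀ k → k < j → v k ⋖ v (suc k))
               × (v j ⊨ ψ)
               × (∀ k → k < j → v k ⊨ φ)

ℒ-CTL± : ∀ {a} → CTL± a → Pred (ΣTree a) 0ℓ
ℒ-CTL± φ t = _⊨_ t ε φ

infixr 6 _∧_
infixr 5 _∨_

data B⁺ (A : Set) : Set where
  ⊤ ⊥     : B⁺ A
  atom    : A → B⁺ A
  _∧_ _∨_ : B⁺ A → B⁺ A → B⁺ A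

atoms : ∀ {A} → B⁺ A → List A
atoms ⊤        = []
atoms ⊥        = []
atoms (atom x) = x ∷ []
atoms (f ∧ g)  = atoms f ++ atoms g
atoms (f ∨ g)  = atoms f ++ atoms g

-- Disjunction of conjunctive clauses.
dnf : ∀ {A} → B⁺ A → List (List A)
dnf ⊤        = [] ∷ []
dnf ⊥        = []
dnf (atom x) = (x ∷ []) ∷ []
dnf (f ∧ g)  = cartesianProductWith _++_ (dnf f) (dnf g)
dnf (f ∨ g)  = dnf f ++ dnf g

-- Conjunction of disjunctive clauses.
cnf : ∀ {A} → B⁺ A → List (List A)
cnf ⊤        = []
cnf ⊥        = [] ∷ []
cnf (atom x) = (x ∷ []) ∷ []
cnf (f ∧ g)  = cnf f ++ cnf g
cnf (f ∨ g)  = cartesianProductWith _++_ (cnf f) (cnf g)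

Satisfies : ∀ {A} → (A → Set) → B⁺ A → Set
Satisfies P ⊤        = Unit
Satisfies P ⊥        = Empty
Satisfies P (atom x) = P x
Satisfies P (f ∧ g)  = Satisfies P f × Satisfies P g
Satisfies P (f ∨ g)  = Satisfies P f ⊎ Satisfies P g

data Atom (Q : Set) : Set where
  ◇ □ : (k : ℕ) → Q → Atom Q

state : ∀ {Q} → Atom Q → Q
state (◇ k q) = q
state (□ k q) = q

record Automaton (a : ℕ) : Set where
  field
    #Q : ℕ

  Q : Set
  Q = Fin #Q

  field
    δ  : Q → Subset a → B⁺ (Atom Q)
    qI : Q
    F  : Subset #Q

module _ {a : ℕ} (A : Automaton a) (t : ΣTree a) where
  open Automaton A
  private module T = ΣTree t

  module _ (r : Tree (Q × T.Dom)) where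
    open Tree r

    HasChild : Dom → Q × T.Dom → Set
    HasChild x l = Σ[ c ∈ Fin (#children x) ] label (x · c) ≡ l

    -- In the □ clause S is the set of exceptional children; ∣ S ∣ < k says
    -- that there are at most k - 1 of them (so □ 0 is never satisfied, dually
    -- to ◇ 0, which always is).
    AtomHolds : (x : Dom) → Atom Q → Set
    AtomHolds x (◇ k q′) =
      let v = proj₂ (label x) in
      Σ[ f ∈ (Fin k → Fin (T.#children v)) ]
        Injective _≡_ _≡_ f × (∀ i → HasChild x (q′ , v · f i))
    AtomHolds x (□ k q′) =
      let v = proj₂ (label x) in
      Σ[ S ∈ Subset (T.#children v) ]
        ∣ S ∣ < k × (∀ i → i ∉ S → HasChild x (q′ , v · i))

    record IsRun (s : T.Dom) : Set where
      field
        initial    : label ε ≡ (qI , s)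
        consistent : ∀ x → let (q , v) = label x in
                     Satisfies (AtomHolds x) (δ q (T.label v))

    IsAccepting : Set
    IsAccepting = (π : ℕ → Dom) → π 0 ≡ ε → (∀ i → π i ⋖ π (suc i)) →
                  ∀ i → ∃[ j ] i ≤ j × proj₁ (label (π j)) ∈ F

ℒ-Aut : ∀ {a} → Automaton a → Pred (ΣTree a) 0ℓ
ℒ-Aut A t = Σ[ r ∈ Tree (Automaton.Q A × ΣTree.Dom t) ]
              IsRun A t r ε × IsAccepting A t r

data Kind : Set where
  transient existential universal : Kind

module _ {a : ℕ} (A : Automaton a) where
  open Automaton A

  -- The components are the fibres of comp.
  module Components {m : ℕ} (comp : Q → Fin m) where

    -- Clauses are sets of atoms, so repetitions in the list do not count.
    AtMostOne : Fin m → List (Atom Q) → Set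
    AtMostOne i c = ∀ x y → x List.∈ c → y List.∈ c →
                    comp (state x) ≡ i → comp (state y) ≡ i → x ≡ y

    IsKind : Kind → Fin m → Set
    IsKind transient i = ∀ q σ → comp q ≡ i →
      ∀ x → x List.∈ atoms (δ q σ) → comp (state x) ≢ i
    IsKind existential i = ∀ q σ → comp q ≡ i →
        (∀ x → x List.∈ atoms (δ q σ) → comp (state x) ≡ i → x ≡ ◇ 1 (state x))
      × (∀ c → c List.∈ dnf (δ q σ) → AtMostOne i c)
    IsKind universal i = ∀ q σ → comp q ≡ i →
        (∀ x → x List.∈ atoms (δ q σ) → comp (state x) ≡ i → x ≡ □ 1 (state x))
      × (∀ c → c List.∈ cnf (δ q σ) → AtMostOne i c)

  -- Each component is assigned one kind.  A component without internal atoms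
  -- meets all three conditions of IsKind, and choosing `transient` for it puts
  -- no constraint on F.
  record Hesitant : Set where
    field
      #components : ℕ
      comp        : Q → Fin #components
      nonempty    : StrictlySurjective _≡_ comp
      ordered     : ∀ q σ x → x List.∈ atoms (δ q σ) →
                    comp (state x) Fin.≤ comp q
      kind        : Fin #components → Kind
      isKind      : ∀ i → Components.IsKind comp (kind i) i

  Polarised : Hesitant → Set
  Polarised H = ∀ q → (kind (comp q) ≡ existential → q ∉ F)
                    × (kind (comp q) ≡ universal → q ∈ F)
    where open Hesitant H

record HTA± (a : ℕ) : Set where
  field
    automaton : Automaton a
    hesitant  : Hesitant automaton
    polarised : Polarised automaton hesitant

  open Automaton automaton public
  open Hesitant hesitant public

Linear : ∀ {a} → HTA± a → Set
Linear A = Injective _≡_ _≡_ (HTA±.comp A)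

ℒ-HTA± : ∀ {a} → HTA± a → Pred (ΣTree a) 0ℓ
ℒ-HTA± A = ℒ-Aut (HTA±.automaton A)

{-# OPTIONS --safe #-}
module Submission where

-- Both directions rest on one adequacy statement.  In a linear automaton the
-- transition formula of a state q is, once the sets of nodes satisfying the
-- smaller states are known, a monotone operator in the set of nodes satisfying
-- q itself, of the form Y ∨ (X ∧ ◇q) or ¬Y ∧ (¬X ∨ □q).  Acceptance from q is
-- its least fixed point E(X U Y) if q is existential (hence rejecting), and its
-- greatest fixed point ¬E(X U Y) if q is universal (hence accepting).
-- Conversely, every E(X U Y) and every ¬E(X U Y) occurring in a formula becomes
-- one such state; arguments of D and EX become transient states, and Boolean
-- connectives are absorbed into the transition formulas.  An accepting run is
-- an unfolding of obligations in which the length of the until-witness drops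
-- as long as the run stays in a rejecting state.

open import Level using (0ℓ)
open import Axiom.ExcludedMiddle using (ExcludedMiddle)
open import Data.Bool using (Bool; true; false; if_then_else_)
open import Data.Empty using (⊥-elim)
open import Data.Fin using (Fin; zero; suc; toℕ; inject≤; opposite)
import Data.Fin as Fin
open import Data.Fin.Induction using (<-wellFounded; >-wellFounded)
import Data.Fin.Properties as Fin
open import Data.Fin.Subset using (Subset; inside; outside; _∈_; _∉_; ∣_∣) renaming (⊥ to ∅)
open import Data.Fin.Subset.Properties using (_∈?_; ∣⊥∣≡0)
open import Data.List using (List; []; _∷_; length; allFin; cartesianProduct)
import Data.List as List
open import Data.List.Membership.Propositional using () renaming (_∈_ to _∈ᴸ_)
open import Data.List.Membership.Propositional.Properties using (∈-++⁺ˡ; ∈-++⁺ʳ; ∈-++⁻; ∈-cartesianProductWith⁻; ∈-cartesianProduct⁺; ∈-allFin; ∈-map⁺; ∈-map⁻)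
open import Data.List.Relation.Unary.All using (All; []; _∷_)
import Data.List.Relation.Unary.All as All
import Data.List.Relation.Unary.All.Properties as All
open import Data.List.Relation.Unary.Any using (here; there)
import Data.List.Relation.Unary.Any as Any
open import Data.Nat using (ℕ; zero; suc; _≤_; _<_; z≤n; s≤s; NonZero; ≢-nonZero⁻¹)
import Data.Nat.Induction as ℕ
import Data.Nat.Properties as ℕ
open import Data.Product using (Σ-syntax; ∃-syntax; _×_; _,_; proj₁; proj₂)
import Data.Product as Product
open import Data.Sum using (_⊎_; inj₁; inj₂; [_,_]′)
import Data.Sum as Sum
open import Data.Unit using (tt)
open import Data.Vec using (Vec; []; _∷_; lookup; tabulate; here; there)
open import Data.Vec.Properties using ([]=⇒lookup; lookup⇒[]=; lookup∘tabulate; tabulate∘lookup)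
open import Function using (_∘_; id; case_of_)
open import Function.Bundles using (_⇔_; mk⇔; Equivalence)
open import Function.Definitions using (Injective)
open import Induction.WellFounded using (Acc; acc; WellFounded)
import Relation.Binary.Construct.On as On
open import Relation.Binary.PropositionalEquality using (_≡_; _≢_; refl; sym; trans; cong; cong₂; subst)
open import Relation.Nullary using (¬_; yes; no; does)
open import Relation.Unary using (_≐_)
open import Defs

open Equivalence using (to; from)

-- Positive Boolean formulae: monotonicity, renaming and clauses.

-- Positive formulae are monotone. Limiting the hypothesis to occurring atoms gives access to the
-- order on states, which is known only for those.
Satisfies-map : ∀ {A} {P R : A → Set} (f : B⁺ A) → (∀ x → x ∈ᴸ atoms f → P x → R x) →
                Satisfies P f → Satisfies R f
Satisfies-map ⊤        h s        = s
Satisfies-map (atom x) h s        = h x (here refl) s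
Satisfies-map (f ∧ g)  h (s , s′) = Satisfies-map f (λ x m → h x (∈-++⁺ˡ m)) s
                                  , Satisfies-map g (λ x m → h x (∈-++⁺ʳ (atoms f) m)) s′
Satisfies-map (f ∨ g)  h (inj₁ s) = inj₁ (Satisfies-map f (λ x m → h x (∈-++⁺ˡ m)) s)
Satisfies-map (f ∨ g)  h (inj₂ s) = inj₂ (Satisfies-map g (λ x m → h x (∈-++⁺ʳ (atoms f) m)) s)

mapB : ∀ {A B} → (A → B) → B⁺ A → B⁺ B
mapB h ⊤        = ⊤
mapB h ⊥        = ⊥
mapB h (atom x) = atom (h x)
mapB h (f ∧ g)  = mapB h f ∧ mapB h g
mapB h (f ∨ g)  = mapB h f ∨ mapB h g

Satisfies-mapB : ∀ {A B} {P : A → Set} {R : B → Set} (h : A → B) (f : B⁺ A) →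
                 (∀ x → P x ⇔ R (h x)) → Satisfies P f ⇔ Satisfies R (mapB h f)
Satisfies-mapB h ⊤        e = mk⇔ id id
Satisfies-mapB h ⊥        e = mk⇔ id id
Satisfies-mapB h (atom x) e = e x
Satisfies-mapB h (f ∧ g)  e = mk⇔ (Product.map (to F) (to G)) (Product.map (from F) (from G))
  where F = Satisfies-mapB h f e
        G = Satisfies-mapB h g e
Satisfies-mapB h (f ∨ g)  e = mk⇔ (Sum.map (to F) (to G)) (Sum.map (from F) (from G))
  where F = Satisfies-mapB h f e
        G = Satisfies-mapB h g e

All-atoms-mapB : ∀ {A B} {R : B → Set} (h : A → B) (f : B⁺ A) →
                 All (R ∘ h) (atoms f) → All R (atoms (mapB h f))
All-atoms-mapB h ⊤        p       = []
All-atoms-mapB h ⊥        p       = []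
All-atoms-mapB h (atom x) (p ∷ _) = p ∷ []
All-atoms-mapB h (f ∧ g)  p       = All.++⁺ (All-atoms-mapB h f (All.++⁻ˡ (atoms f) p))
                                            (All-atoms-mapB h g (All.++⁻ʳ (atoms f) p))
All-atoms-mapB h (f ∨ g)  p       = All.++⁺ (All-atoms-mapB h f (All.++⁻ˡ (atoms f) p))
                                            (All-atoms-mapB h g (All.++⁻ʳ (atoms f) p))

product-atoms : ∀ {A : Set} (xss yss : List (List A)) {c x} → c ∈ᴸ List.cartesianProductWith List._++_ xss yss →
                x ∈ᴸ c → (∃[ d ] d ∈ᴸ xss × x ∈ᴸ d) ⊎ (∃[ d ] d ∈ᴸ yss × x ∈ᴸ d)
product-atoms xss yss m x∈c with ∈-cartesianProductWith⁻ List._++_ xss yss m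
... | d , e , d∈ , e∈ , refl = Sum.map (λ p → d , d∈ , p) (λ p → e , e∈ , p) (∈-++⁻ d x∈c)

-- Reduces the condition on clauses of an existential component to a property of all atoms of the
-- formula.
dnf-atoms : ∀ {A} (f : B⁺ A) {c x} → c ∈ᴸ dnf f → x ∈ᴸ c → x ∈ᴸ atoms f
dnf-atoms ⊤        (here refl) ()
dnf-atoms (atom y) (here refl) m = m
dnf-atoms (f ∧ g)  c∈ m with product-atoms (dnf f) (dnf g) c∈ m
... | inj₁ (_ , d∈ , m′) = ∈-++⁺ˡ (dnf-atoms f d∈ m′)
... | inj₂ (_ , d∈ , m′) = ∈-++⁺ʳ (atoms f) (dnf-atoms g d∈ m′)
dnf-atoms (f ∨ g)  c∈ m with ∈-++⁻ (dnf f) c∈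
... | inj₁ d∈ = ∈-++⁺ˡ (dnf-atoms f d∈ m)
... | inj₂ d∈ = ∈-++⁺ʳ (atoms f) (dnf-atoms g d∈ m)

cnf-atoms : ∀ {A} (f : B⁺ A) {c x} → c ∈ᴸ cnf f → x ∈ᴸ c → x ∈ᴸ atoms f
cnf-atoms ⊥        (here refl) ()
cnf-atoms (atom y) (here refl) m = m
cnf-atoms (f ∨ g)  c∈ m with product-atoms (cnf f) (cnf g) c∈ m
... | inj₁ (_ , d∈ , m′) = ∈-++⁺ˡ (cnf-atoms f d∈ m′)
... | inj₂ (_ , d∈ , m′) = ∈-++⁺ʳ (atoms f) (cnf-atoms g d∈ m′)
cnf-atoms (f ∧ g)  c∈ m with ∈-++⁻ (cnf f) c∈
... | inj₁ d∈ = ∈-++⁺ˡ (cnf-atoms f d∈ m)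
... | inj₂ d∈ = ∈-++⁺ʳ (atoms f) (cnf-atoms g d∈ m)

-- Counting modalities over the children of a node.

mapAtom : ∀ {Q Q′} → (Q → Q′) → Atom Q → Atom Q′
mapAtom h (◇ k q) = ◇ k (h q)
mapAtom h (□ k q) = □ k (h q)

state-mapAtom : ∀ {Q Q′} (h : Q → Q′) (x : Atom Q) → state (mapAtom h x) ≡ h (state x)
state-mapAtom h (◇ k q) = refl
state-mapAtom h (□ k q) = refl

AtLeast AllBut : ∀ {n} → ℕ → (Fin n → Set) → Set
AtLeast {n} k R = Σ[ f ∈ (Fin k → Fin n) ] Injective _≡_ _≡_ f × (∀ i → R (f i))
AllBut  {n} k R = Σ[ S ∈ Subset n ] ∣ S ∣ < k × (∀ i → i ∉ S → R i)

-- R q i stands for: state q holds at the i-th child.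
Holds : ∀ {Q n} → (Q → Fin n → Set) → Atom Q → Set
Holds R (◇ k q) = AtLeast k (R q)
Holds R (□ k q) = AllBut k (R q)

Holds-map : ∀ {Q n} {R R′ : Q → Fin n → Set} (x : Atom Q) →
            (∀ i → R (state x) i → R′ (state x) i) → Holds R x → Holds R′ x
Holds-map (◇ k q) h (f , inj , p) = f , inj , λ i → h (f i) (p i)
Holds-map (□ k q) h (S , lt , p)  = S , lt , λ i i∉S → h i (p i i∉S)

Holds-mapAtom : ∀ {Q Q′ n} {R : Q → Fin n → Set} {R′ : Q′ → Fin n → Set} (h : Q → Q′) →
                (∀ q i → R q i ⇔ R′ (h q) i) → ∀ x → Holds R x ⇔ Holds R′ (mapAtom h x)
Holds-mapAtom h e (◇ k q) = mk⇔ (λ (f , inj , p) → f , inj , λ i → to (e q (f i)) (p i))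
                                (λ (f , inj , p) → f , inj , λ i → from (e q (f i)) (p i))
Holds-mapAtom h e (□ k q) = mk⇔ (λ (S , lt , p) → S , lt , λ i i∉S → to (e q i) (p i i∉S))
                                (λ (S , lt , p) → S , lt , λ i i∉S → from (e q i) (p i i∉S))

AtLeast-one : ∀ {n} {R : Fin n → Set} → AtLeast 1 R ⇔ (∃[ i ] R i)
AtLeast-one = mk⇔ (λ (f , _ , p) → f zero , p zero)
                  (λ (i , r) → (λ _ → i) , (λ { {zero} {zero} _ → refl }) , λ _ → r)

-- Together with `index`, this exchanges cardinality bounds on subsets for injections between finite
-- types.
enum : ∀ {n} (S : Subset n) → Fin ∣ S ∣ → Fin n
enum (inside  ∷ S) zero    = zero
enum (inside  ∷ S) (suc j) = suc (enum S j)
enum (outside ∷ S) j       = suc (enum S j)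

enum-∈ : ∀ {n} (S : Subset n) j → enum S j ∈ S
enum-∈ (inside  ∷ S) zero    = here
enum-∈ (inside  ∷ S) (suc j) = there (enum-∈ S j)
enum-∈ (outside ∷ S) j       = there (enum-∈ S j)

enum-injective : ∀ {n} (S : Subset n) → Injective _≡_ _≡_ (enum S)
enum-injective (inside  ∷ S) {zero}  {zero}  eq = refl
enum-injective (inside  ∷ S) {suc j} {suc l} eq = cong suc (enum-injective S (Fin.suc-injective eq))
enum-injective (outside ∷ S)                 eq = enum-injective S (Fin.suc-injective eq)

index : ∀ {n} {S : Subset n} {i} → i ∈ S → Fin ∣ S ∣
index {S = inside  ∷ S} here      = zero
index {S = inside  ∷ S} (there p) = suc (index p)
index {S = outside ∷ S} (there p) = index p

index-injective : ∀ {n} {S : Subset n} {i j} (p : i ∈ S) (q : j ∈ S) → index p ≡ index q → i ≡ j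
index-injective {S = inside  ∷ S} here      here      eq = refl
index-injective {S = inside  ∷ S} (there p) (there q) eq = cong suc (index-injective p q (Fin.suc-injective eq))
index-injective {S = outside ∷ S} (there p) (there q) eq = cong suc (index-injective p q eq)

AllBut-one : ∀ {n} {R : Fin n → Set} → AllBut 1 R ⇔ (∀ i → R i)
AllBut-one {n} = mk⇔
  -- With fewer than one exception, a member of `S` would have its index in `Fin 0`.
  (λ (S , lt , p) i → p i λ i∈S → case subst Fin (ℕ.n≤0⇒n≡0 (ℕ.≤-pred lt)) (index i∈S) of λ ())
  (λ r → ∅ , s≤s (ℕ.≤-reflexive (∣⊥∣≡0 n)) , λ i _ → r i)

-- Trees unfolded from a successor function.

module Unfolding {S : Set} (children : S → List S) (s₀ : S) where

  -- The default s₀ of nth is never used at the address of a node.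
  nth : List S → ℕ → S
  nth []       k       = s₀
  nth (s ∷ ss) zero    = s
  nth (s ∷ ss) (suc k) = nth ss k

  at : List ℕ → S
  at []      = s₀
  at (k ∷ w) = nth (children (at w)) k

  nth-∈ : ∀ ss (i : Fin (length ss)) → nth ss (toℕ i) ∈ᴸ ss
  nth-∈ (s ∷ ss) zero    = here refl
  nth-∈ (s ∷ ss) (suc i) = there (nth-∈ ss i)

  nth-index : ∀ {s ss} (m : s ∈ᴸ ss) → nth ss (toℕ (Any.index m)) ≡ s
  nth-index (here refl) = refl
  nth-index (there m)   = nth-index m

  unfold : ∀ {L} → (S → L) → Tree L
  unfold l = record { arity = λ w → length (children (at w)) ; label = λ u → l (at (addr u)) }

-- Until-witnesses and the fixed-point specification of states.

module _ {a : ℕ} (t : ΣTree a) where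
  open ΣTree t

  -- The exact length of the witness is kept as an index because it later serves as the decreasing
  -- rank of a rejecting state.
  Until : (X Y : Dom → Set) → ℕ → Dom → Set
  Until X Y zero    v = Y v
  Until X Y (suc n) v = X v × (∃[ i ] Until X Y n (v · i))

  EU⇔Until : ∀ φ ψ u → _⊨_ t u (EU φ ψ) ⇔ (∃[ n ] Until (λ v → _⊨_ t v φ) (λ v → _⊨_ t v ψ) n u)
  EU⇔Until φ ψ u = mk⇔ (λ (j , v , v₀ , path , end , before) → j , shorten j v v₀ path end before)
                        (λ (n , w) → n , lengthen n w)
    where
    shorten : ∀ j (v : ℕ → Dom) {u} → v 0 ≡ u → (∀ k → k < j → v k ⋖ v (suc k)) →
              _⊨_ t (v j) ψ → (∀ k → k < j → _⊨_ t (v k) φ) →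
              Until (λ v → _⊨_ t v φ) (λ v → _⊨_ t v ψ) j u
    shorten zero    v refl path end before = end
    shorten (suc j) v refl path end before =
      before 0 (s≤s z≤n) , proj₁ (path 0 (s≤s z≤n)) ,
      shorten j (v ∘ suc) (proj₂ (path 0 (s≤s z≤n))) (λ k → path (suc k) ∘ s≤s) end (λ k → before (suc k) ∘ s≤s)

    lengthen : ∀ n {u} → Until (λ v → _⊨_ t v φ) (λ v → _⊨_ t v ψ) n u →
               Σ[ v ∈ (ℕ → Dom) ] v 0 ≡ u × (∀ k → k < n → v k ⋖ v (suc k)) × (_⊨_ t (v n) ψ)
                                × (∀ k → k < n → _⊨_ t (v k) φ)
    lengthen zero    {u} y = (λ _ → u) , refl , (λ _ ()) , y , λ _ ()
    lengthen (suc n) {u} (x , i , w) with lengthen n w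
    ... | v , v₀ , path , end , before =
      (λ { zero → u ; (suc k) → v k }) , refl ,
      (λ { zero _ → i , v₀ ; (suc k) (s≤s lt) → path k lt }) , end ,
      (λ { zero _ → x ; (suc k) (s≤s lt) → before k lt })

  module Semantics {N : ℕ} (δ : Fin N → Subset a → B⁺ (Atom (Fin N))) (F : Subset N)
                   (_≺_ : Fin N → Fin N → Set) (P : Fin N → Dom → Set) where

    -- Smaller states take their known meaning and `q` itself the assumed one. Every other state is
    -- false; the order excludes it from the transition formula of `q`.
    Mix : (q : Fin N) → (Dom → Set) → (v : Dom) → Fin N → Fin (#children v) → Set
    Mix q Z v q′ i = (q′ ≺ q × P q′ (v · i)) ⊎ (q′ ≡ q × Z (v · i))

    -- The transition formula of q at v, as an operator in the set Z of nodes
    -- at which q itself is assumed to hold.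
    Local : Fin N → (Dom → Set) → Dom → Set
    Local q Z v = Satisfies (Holds (Mix q Z v)) (δ q (label v))

    -- In the second and third case P q is the least, respectively greatest,
    -- fixed point of Local q.
    data Spec (q : Fin N) : Set₁ where
      local    : (∀ Z v → P q v ⇔ Local q Z v) → Spec q
      least    : q ∉ F → (X Y : Dom → Set) → (∀ v → P q v ⇔ (∃[ n ] Until X Y n v)) →
                 (∀ Z v → Local q Z v ⇔ (Y v ⊎ (X v × (∃[ i ] Z (v · i))))) → Spec q
      greatest : q ∈ F → (X Y : Dom → Set) → (∀ v → P q v ⇔ (¬ (∃[ n ] Until X Y n v))) →
                 (∀ Z v → Local q Z v ⇔ ((¬ Y v) × ((¬ X v) ⊎ (∀ i → Z (v · i))))) → Spec q

-- Classical duality, filtering and fixed-point equations.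

module Classical (em : ExcludedMiddle 0ℓ) where

  stable : {P : Set} → ¬ ¬ P → P
  stable {P} ¬¬p with em {P}
  ... | yes p = p
  ... | no ¬p = ⊥-elim (¬¬p ¬p)

  comprehension : ∀ {n} → (Fin n → Set) → Subset n
  comprehension R = tabulate (λ i → does (em {R i}))

  ∈-comprehension : ∀ {n} (R : Fin n → Set) i → i ∈ comprehension R ⇔ R i
  ∈-comprehension R i = mk⇔ forth back
    where
    eq : lookup (comprehension R) i ≡ does (em {R i})
    eq = lookup∘tabulate (λ i → does (em {R i})) i
    forth : i ∈ comprehension R → R i
    forth m with em {R i} | trans (sym eq) ([]=⇒lookup m)
    ... | yes r | _ = r
    ... | no _  | ()
    back : R i → i ∈ comprehension R
    back r with em {R i} | eq
    ... | yes _ | eq = lookup⇒[]= i _ eq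
    ... | no ¬r | _  = ⊥-elim (¬r r)

  -- If `k` distinct children fail, they inject into the exceptional set, which is too small.
  -- Conversely the set of all failures is an exceptional set, and enumerating it would give `k`
  -- failures if it were too large.
  AllBut⇔¬AtLeast : ∀ {n} k (R : Fin n → Set) → AllBut k R ⇔ (¬ AtLeast k (λ i → ¬ R i))
  AllBut⇔¬AtLeast {n} k R = mk⇔ forth back
    where
    forth : AllBut k R → ¬ AtLeast k (λ i → ¬ R i)
    forth (S , lt , p) (f , inj , ¬r) = ℕ.<⇒≱ lt (Fin.injective⇒≤ (λ {i} {j} eq →
      inj (index-injective (exceptional i) (exceptional j) eq)))
      where
      exceptional : ∀ i → f i ∈ S
      exceptional i with f i ∈? S
      ... | yes m = m
      ... | no ∉S = ⊥-elim (¬r i (p (f i) ∉S))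
    S : Subset n
    S = comprehension (λ i → ¬ R i)
    back : ¬ AtLeast k (λ i → ¬ R i) → AllBut k R
    back few = S , ℕ.≰⇒> large , λ i i∉S → stable (i∉S ∘ from (∈-comprehension _ i))
      where
      large : ¬ (k ≤ ∣ S ∣)
      large k≤ = few ( (λ j → enum S (inject≤ j k≤))
                     , (λ eq → Fin.inject≤-injective k≤ k≤ _ _ (enum-injective S eq))
                     , (λ j → to (∈-comprehension _ _) (enum-∈ S (inject≤ j k≤))))

  choose : ∀ {I : Set} (R : I → Set) → List I → List (Σ[ i ∈ I ] R i)
  choose R []       = []
  choose R (i ∷ is) with em {R i}
  ... | yes r = (i , r) ∷ choose R is
  ... | no _  = choose R is

  -- The stored proof is the one that excluded middle supplies, which may differ from the given one;
  -- hence the existential conclusion.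
  choose-complete : ∀ {I : Set} (R : I → Set) {i is} → i ∈ᴸ is → R i → Σ[ r ∈ R i ] (i , r) ∈ᴸ choose R is
  choose-complete R {i} (here refl) r with em {R i}
  ... | yes r′ = r′ , here refl
  ... | no ¬r  = ⊥-elim (¬r r)
  choose-complete R {is = j ∷ _} (there m) r with em {R j}
  ... | yes _ = Product.map₂ there (choose-complete R m r)
  ... | no _  = choose-complete R m r

  Until-unfold : ∀ {a} (t : ΣTree a) (X Y : ΣTree.Dom t → Set) v →
                 (∃[ n ] Until t X Y n v) ⇔ (Y v ⊎ (X v × (∃[ i ] ∃[ n ] Until t X Y n (v · i))))
  Until-unfold t X Y v = mk⇔
    (λ { (zero , y) → inj₁ y ; (suc n , x , i , w) → inj₂ (x , i , n , w) })
    (λ { (inj₁ y) → zero , y ; (inj₂ (x , i , n , w)) → suc n , x , i , w })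

  -- The dual of the least fixed-point equation. Deciding `X v` turns the negated conjunction into a
  -- disjunction.
  ¬Until-unfold : ∀ {a} (t : ΣTree a) (X Y : ΣTree.Dom t → Set) v →
                  (¬ (∃[ n ] Until t X Y n v)) ⇔
                  ((¬ Y v) × ((¬ X v) ⊎ (∀ i → ¬ (∃[ n ] Until t X Y n (v · i)))))
  ¬Until-unfold t X Y v = mk⇔ forth back
    where
    open ΣTree t
    forth : ¬ (∃[ n ] Until t X Y n v) → _
    forth none = (λ y → none (zero , y)) , choice
      where
      choice : (¬ X v) ⊎ (∀ i → ¬ (∃[ n ] Until t X Y n (v · i)))
      choice with em {X v}
      ... | yes x = inj₂ λ i (n , w) → none (suc n , x , i , w)
      ... | no ¬x = inj₁ ¬x
    back : _ → ¬ (∃[ n ] Until t X Y n v)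
    back (¬y , _)       (zero , y)          = ¬y y
    back (_ , inj₁ ¬x)  (suc n , x , _)     = ¬x x
    back (_ , inj₂ all) (suc n , _ , i , w) = all i (n , w)

  -- Adequacy: acceptance agrees with the fixed-point specification.

  module Adequacy {a : ℕ} (t : ΣTree a) (A : Automaton a)
                  (_≺_ : Automaton.Q A → Automaton.Q A → Set) (wf : WellFounded _≺_)
                  (ordered : ∀ q σ x → x ∈ᴸ atoms (Automaton.δ A q σ) → state x ≺ q ⊎ state x ≡ q)
                  (P : Automaton.Q A → ΣTree.Dom t → Set)
                  (spec : ∀ q → Semantics.Spec t (Automaton.δ A) (Automaton.F A) _≺_ P q) where
    open ΣTree t
    open Automaton A
    open Semantics t δ F _≺_ P

    private
      -- Only a least fixed point needs a measure, the length of an until-witness; in the other two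
      -- cases the number is arbitrary.
      Rank : ∀ {q} → Spec q → ℕ → Dom → Set
      Rank {q} (local _)            n v = P q v
      Rank {q} (least _ X Y _ _)    n v = Until t X Y n v
      Rank {q} (greatest _ _ _ _ _) n v = P q v

      ranked : ∀ {q} (s : Spec q) {v} → P q v → ∃[ n ] Rank s n v
      ranked (local _)            p = 0 , p
      ranked (least _ _ _ e _)    p = to (e _) p
      ranked (greatest _ _ _ _ _) p = 0 , p

      -- Lexicographic descent in state and rank, suspended at accepting states. An infinite path
      -- obeying it at every step must visit `F` again and again.
      Progress : Q → ℕ → Q → ℕ → Set
      Progress q n q′ m = q ∈ F ⊎ q′ ≺ q ⊎ (q′ ≡ q × m < n)

      Obligation : Q → ℕ → (v : Dom) → Q × Fin (#children v) → Set
      Obligation q n v (q′ , i) = ∃[ m ] Rank (spec q′) m (v · i) × Progress q n q′ m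

      Local⇒obligations : ∀ {q n v} (Z : Dom → Set) → (∀ i → Z (v · i) → Obligation q n v (q , i)) →
        Local q Z v → Satisfies (Holds (λ q′ i → Obligation q n v (q′ , i))) (δ q (label v))
      Local⇒obligations {q} {n} {v} Z own = Satisfies-map (δ q (label v)) λ x _ → Holds-map x λ where
        i (inj₁ (lower , p))  → Product.map₂ (λ r → r , inj₂ (inj₁ lower)) (ranked (spec _) p)
        i (inj₂ (refl , z))   → own i z

      -- The operator is applied to a set chosen by case: the empty one (`Fin 0`) where no child has
      -- to stay in `q`, the witnesses of length `n` at rank `suc n`, and `P q` itself for a
      -- greatest fixed point. The equation with `spec q` transports the ranks of children that stay
      -- in `q`.
      step : ∀ {q} (s : Spec q) → spec q ≡ s → ∀ n v → Rank s n v →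
             Satisfies (Holds (λ q′ i → Obligation q n v (q′ , i))) (δ q (label v))
      step (local e) _ n v p = Local⇒obligations {n = n} (λ _ → Fin 0) (λ _ ()) (to (e (λ _ → Fin 0) v) p)
      step (least _ X Y _ l) _ zero v y =
        Local⇒obligations {n = 0} (λ _ → Fin 0) (λ _ ()) (from (l (λ _ → Fin 0) v) (inj₁ y))
      step {q} (least _ X Y _ l) eq (suc n) v (x , i , w) =
        Local⇒obligations (Until t X Y n)
          (λ j u → n , subst (λ s → Rank s n (v · j)) (sym eq) u , inj₂ (inj₂ (refl , ℕ.≤-refl)))
          (from (l (Until t X Y n) v) (inj₂ (x , i , w)))
      step {q} (greatest q∈F X Y e l) eq n v p =
        Local⇒obligations (P q)
          (λ j p′ → n , subst (λ s → Rank s n (v · j)) (sym eq) p′ , inj₁ q∈F)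
          (from (l (P q) v) (Product.map₂ (Sum.map₂ λ none i → from (e (v · i)) (none i))
                                      (to (¬Until-unfold t X Y v) (to (e v) p))))

      S : Set
      S = Σ[ q ∈ Q ] Σ[ v ∈ Dom ] ∃[ n ] Rank (spec q) n v

      stateOf : S → Q
      stateOf (q , _) = q

      rankOf : S → ℕ
      rankOf (_ , _ , n , _) = n

      discharge : ∀ {q n v} → (Σ[ qi ∈ Q × Fin (#children v) ] Obligation q n v qi) → S
      discharge {v = v} ((q′ , i) , m , r , _) = q′ , v · i , m , r

      -- All pairs of a state and a child with some obligation are taken, so no satisfying set of
      -- atoms has to be selected.
      children : S → List S
      children (q , v , n , _) = List.map discharge
        (choose (Obligation q n v) (cartesianProduct (allFin #Q) (allFin (#children v))))

      children-progress : ∀ s s′ → s′ ∈ᴸ children s → Progress (stateOf s) (rankOf s) (stateOf s′) (rankOf s′)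
      children-progress s s′ m with ∈-map⁻ discharge m
      ... | (_ , _ , _ , progress) , _ , refl = progress

    sound : P qI ε → ℒ-Aut A t
    sound p = r , record { initial = refl ; consistent = consistent } , accepting
      where
      open Unfolding children (qI , ε , ranked (spec qI) p)

      label′ : S → Q × Dom
      label′ (q , v , _) = q , v

      r : Tree (Q × Dom)
      r = unfold label′
      module R = Tree r

      -- The child found may carry another rank and proof than `o`, but labels forget both.
      hasChild : ∀ x → let (q , v , n , _) = at (addr x) in
                 ∀ {q′ i} → Obligation q n v (q′ , i) → HasChild A t r x (q′ , v · i)
      hasChild x {q′} {i} o
        with choose-complete (Obligation _ _ _) (∈-cartesianProduct⁺ (∈-allFin q′) (∈-allFin i)) o
      ... | o′ , m = Any.index m′ , cong label′ (nth-index m′)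
        where m′ = ∈-map⁺ discharge m

      consistent : ∀ x → let (q , v) = R.label x in Satisfies (AtomHolds A t r x) (δ q (label v))
      consistent x =
        let (q , v , n , rank) = at (addr x)
        in Satisfies-map (δ q (label v)) (λ y _ → atomHolds y) (step (spec q) refl n v rank)
        where
        atomHolds : let (q , v , n , _) = at (addr x) in
                    ∀ y → Holds (λ q′ i → Obligation q n v (q′ , i)) y → AtomHolds A t r x y
        atomHolds (◇ k q) (f , inj , o) = f , inj , λ i → hasChild x (o i)
        atomHolds (□ k q) (T , lt , o)  = T , lt , λ i i∉T → hasChild x (o i i∉T)

      accepting : IsAccepting A t r
      accepting π _ path i = go i (wf _) refl
        where
        s : ℕ → S
        s j = at (addr (π j))

        progress : ∀ j → Progress (stateOf (s j)) (rankOf (s j)) (stateOf (s (suc j))) (rankOf (s (suc j)))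
        progress j with path j
        ... | c , eq = children-progress (s j) (s (suc j))
              (subst (λ u → at (addr u) ∈ᴸ children (s j)) (sym eq) (nth-∈ (children (s j)) c))

        -- Outer induction on the state, inner induction (`descend`) on the rank: until an accepting
        -- state is met, each step lowers one of the two lexicographically.
        go : ∀ j {q} → Acc _≺_ q → stateOf (s j) ≡ q → ∃[ k ] j ≤ k × proj₁ (R.label (π k)) ∈ F
        go j {q} (acc rq) eq = descend j (ℕ.<-wellFounded _) eq (from-state j eq)
          where
          from-state : ∀ j → stateOf (s j) ≡ q → Progress q (rankOf (s j)) (stateOf (s (suc j))) (rankOf (s (suc j)))
          from-state j eq = subst (λ q → Progress q _ _ _) eq (progress j)

          descend : ∀ j {n} → Acc _<_ n → stateOf (s j) ≡ q →
                    Progress q n (stateOf (s (suc j))) (rankOf (s (suc j))) →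
                    ∃[ k ] j ≤ k × proj₁ (R.label (π k)) ∈ F
          descend j _        eq (inj₁ q∈F)                = j , ℕ.≤-refl , subst (_∈ F) (sym eq) q∈F
          descend j _        _  (inj₂ (inj₁ lower))       =
            Product.map₂ (Product.map₁ ℕ.<⇒≤) (go (suc j) (rq lower) refl)
          descend j (acc rn) _  (inj₂ (inj₂ (same , lt))) =
            Product.map₂ (Product.map₁ ℕ.<⇒≤) (descend (suc j) (rn lt) same (from-state (suc j) same))

    -- Well-founded induction on states establishes `P q v` at every node of the run labelled
    -- `(q , v)`, not only at the root.
    complete : ℒ-Aut A t → P qI ε
    complete (r , run , accepting) = holds (wf qI) ε initial
      where
      open IsRun run
      module R = Tree r

      -- Acceptance speaks of paths from the root, so the ancestors of `x` are prepended one at a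
      -- time. Each shifts positions by one, hence the request for a visit from `suc i` on.
      accepting-from : ∀ x (π : ℕ → R.Dom) → π 0 ≡ x → (∀ i → π i R.⋖ π (suc i)) →
                       ∀ i → ∃[ j ] i ≤ j × proj₁ (R.label (π j)) ∈ F
      accepting-from ε       π π₀ path i = accepting π π₀ path i
      accepting-from (x · c) π π₀ path i
        with accepting-from x (λ { zero → x ; (suc k) → π k }) refl
               (λ { zero → c , π₀ ; (suc k) → path k }) (suc i)
      ... | suc j , s≤s i≤j , f = j , i≤j , f

      -- The set to which a run node `x` applies the local operator of its own state.
      HasOwnChild : R.Dom → Q → Dom → Set
      HasOwnChild x q w = Σ[ c ∈ Fin (R.#children x) ] R.label (x · c) ≡ (q , w)

      Hereditary : Q → Set
      Hereditary q = ∀ {q′} → q′ ≺ q → ∀ x {w} → R.label x ≡ (q′ , w) → P q′ w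

      run-local : ∀ x {q v} → Hereditary q → R.label x ≡ (q , v) → Local q (HasOwnChild x q) v
      -- The statement is proved for the two projections of the label and then transported along
      -- `eq`.
      run-local x {q} {v} ih eq = subst
        (λ (q , v) → Hereditary q → Local q (HasOwnChild x q) v) eq
        (λ ih → Satisfies-map (δ (proj₁ (R.label x)) (label (proj₂ (R.label x)))) (convert ih) (consistent x)) ih
        where
        mix : ∀ {q q′ v i} → Hereditary q → q′ ≺ q ⊎ q′ ≡ q → HasChild A t r x (q′ , v · i) →
              Mix q (HasOwnChild x q) v q′ i
        mix ih (inj₁ lower) (c , e) = inj₁ (lower , ih lower (x · c) e)
        mix ih (inj₂ refl)  child   = inj₂ (refl , child)
        convert : let (q , v) = R.label x in Hereditary q → ∀ y → y ∈ᴸ atoms (δ q (label v)) →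
                  AtomHolds A t r x y → Holds (Mix q (HasOwnChild x q) v) y
        convert ih y@(◇ k q′) m = Product.map₂ (Product.map₂ λ h i → mix ih (ordered _ _ y m) (h i))
        convert ih y@(□ k q′) m = Product.map₂ (Product.map₂ λ h i i∉S → mix ih (ordered _ _ y m) (h i i∉S))

      spec-holds : ∀ {q} → Spec q → Hereditary q → ∀ x {v} → R.label x ≡ (q , v) → P q v
      spec-holds (local e) ih x eq = from (e (HasOwnChild x _) _) (run-local x ih eq)
      spec-holds {q} (greatest _ X Y e l) ih x eq = from (e _) λ (n , w) → refute n x eq w
        where
        -- The run is forced along any until-witness: while `X` holds, every child must again be
        -- visited in state `q`, and the last node violates `¬ Y`.
        refute : ∀ n x {v} → R.label x ≡ (q , v) → ¬ Until t X Y n v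
        refute zero    x eq y = proj₁ (to (l (HasOwnChild x q) _) (run-local x ih eq)) y
        refute (suc n) x eq (xv , i , w) with proj₂ (to (l (HasOwnChild x q) _) (run-local x ih eq))
        ... | inj₁ ¬xv = ¬xv xv
        ... | inj₂ all = refute n (x · proj₁ (all i)) (proj₂ (all i)) w
      -- A failing node of the run has a failing child in the same rejecting state.
      spec-holds {q} (least q∉F X Y e l) ih x {v} eq = stable λ ¬p →
        let π = λ n → iterate n (x , v , eq , ¬p)
            j , _ , q∈F = accepting-from x (proj₁ ∘ π) refl (λ n → proj₂ (next (π n))) 0
        in q∉F (subst (_∈ F) (cong proj₁ (proj₁ (proj₂ (proj₂ (π j))))) q∈F)
        where
        Bad : Set
        Bad = Σ[ x ∈ R.Dom ] ∃[ v ] R.label x ≡ (q , v) × ¬ P q v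
        next : (b : Bad) → Σ[ b′ ∈ Bad ] proj₁ b R.⋖ proj₁ b′
        next (x , v , eq , ¬p) with to (l (HasOwnChild x q) v) (run-local x ih eq)
        ... | inj₁ y = ⊥-elim (¬p (from (e v) (0 , y)))
        ... | inj₂ (xv , i , c , eq′) = (x · c , v · i , eq′ , ¬p′) , c , refl
          where
          ¬p′ : ¬ P q (v · i)
          ¬p′ p′ = let n , w = to (e (v · i)) p′ in ¬p (from (e v) (suc n , xv , i , w))
        iterate : ℕ → Bad → Bad
        iterate zero    b = b
        iterate (suc n) b = proj₁ (next (iterate n b))

      holds : ∀ {q} → Acc _≺_ q → ∀ x {v} → R.label x ≡ (q , v) → P q v
      holds {q} (acc rs) = spec-holds (spec q) (λ lower → holds (rs lower))

    adequate : ℒ-Aut A t ⇔ P qI ε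
    adequate = mk⇔ complete sound

  -- Conjunction and label-dependent formulae.

  _and_ : ∀ {a} → CTL± a → CTL± a → CTL± a
  φ and ψ = neg (or (neg φ) (neg ψ))

  ⊨-and : ∀ {a} (t : ΣTree a) u φ ψ → _⊨_ t u (φ and ψ) ⇔ (_⊨_ t u φ × _⊨_ t u ψ)
  ⊨-and t u φ ψ = mk⇔ (λ h → stable (h ∘ inj₁) , stable (h ∘ inj₂)) (λ (p , q) → [ (λ ¬p → ¬p p) , (λ ¬q → ¬q q) ]′)

  -- A decision tree on the atomic propositions, with the formula G σ at leaf σ.
  select : ∀ {a k} → (Fin k → Fin a) → (Subset k → CTL± a) → CTL± a
  select {k = zero}  ρ G = G []
  select {k = suc k} ρ G = or (var (ρ zero) and select (ρ ∘ suc) (G ∘ (inside ∷_)))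
                              (neg (var (ρ zero)) and select (ρ ∘ suc) (G ∘ (outside ∷_)))

  select-cong : ∀ {a k} (ρ : Fin k → Fin a) {G G′ : Subset k → CTL± a} →
                (∀ σ → G σ ≡ G′ σ) → select ρ G ≡ select ρ G′
  select-cong {k = zero}  ρ e = e []
  select-cong {k = suc k} ρ e = cong₂ (λ φ ψ → or (var (ρ zero) and φ) (neg (var (ρ zero)) and ψ))
    (select-cong (ρ ∘ suc) (e ∘ (inside ∷_))) (select-cong (ρ ∘ suc) (e ∘ (outside ∷_)))

  -- Each recursive call drops one proposition, so the label has to be read through the renaming
  -- `ρ`.
  ⊨-select : ∀ {a k} (t : ΣTree a) u (ρ : Fin k → Fin a) (G : Subset k → CTL± a) →
             _⊨_ t u (select ρ G) ⇔ _⊨_ t u (G (tabulate (λ i → lookup (ΣTree.label t u) (ρ i))))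
  ⊨-select {k = zero}  t u ρ G = mk⇔ id id
  ⊨-select {k = suc k} t u ρ G with lookup (ΣTree.label t u) (ρ zero) in eq
  ... | inside  = mk⇔
          [ (λ h → to (⊨-select t u (ρ ∘ suc) _) (proj₂ (to (⊨-and t u _ _) h)))
          , (λ h → ⊥-elim (proj₁ (to (⊨-and t u _ _) h) (lookup⇒[]= _ _ eq))) ]′
          (λ h → inj₁ (from (⊨-and t u _ _) (lookup⇒[]= _ _ eq , from (⊨-select t u (ρ ∘ suc) _) h)))
  ... | outside = mk⇔
          [ (λ h → ⊥-elim (absent (proj₁ (to (⊨-and t u _ _) h))))
          , (λ h → to (⊨-select t u (ρ ∘ suc) _) (proj₂ (to (⊨-and t u _ _) h))) ]′
          (λ h → inj₂ (from (⊨-and t u _ _) (absent , from (⊨-select t u (ρ ∘ suc) _) h)))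
    where
    absent : ρ zero ∉ ΣTree.label t u
    absent m with () ← trans (sym eq) ([]=⇒lookup m)

  ⊨-select-label : ∀ {a} (t : ΣTree a) u (G : Subset a → CTL± a) →
                   _⊨_ t u (select id G) ⇔ _⊨_ t u (G (ΣTree.label t u))
  ⊨-select-label t u G = subst (λ σ → _⊨_ t u (select id G) ⇔ _⊨_ t u (G σ))
                               (tabulate∘lookup (ΣTree.label t u)) (⊨-select t u id G)

  -- From linear automata to formulae.

  module FromAutomaton {a : ℕ} (A : HTA± a) (linear : Linear A) (p₀ : Fin a) where
    open HTA± A

    _≺_ : Q → Q → Set
    q′ ≺ q = comp q′ Fin.< comp q

    below-or-equal : ∀ q σ x → x ∈ᴸ atoms (δ q σ) → state x ≺ q ⊎ state x ≡ q
    below-or-equal q σ x m with ℕ.m≤n⇒m<n∨m≡n (ordered q σ x m)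
    ... | inj₁ lt = inj₁ lt
    ... | inj₂ eq = inj₂ (linear (Fin.toℕ-injective eq))

    -- The grammar has no truth constants, so a tautology over the fixed proposition `p₀` stands in.
    constant : Bool → CTL± a
    constant true  = or (var p₀) (neg (var p₀))
    constant false = neg (constant true)

    literal : (Q → CTL± a) → Atom Q → CTL± a
    literal ψ (◇ k q) = D k (ψ q)
    literal ψ (□ k q) = neg (D k (neg (ψ q)))

    substAtom : (Q → CTL± a) → Q → Bool → Atom Q → CTL± a
    substAtom ψ q b x = if does (state x Fin.≟ q) then constant b else literal ψ x

    translate : (Q → CTL± a) → Q → Bool → B⁺ (Atom Q) → CTL± a
    translate ψ q b ⊤        = constant true
    translate ψ q b ⊥        = constant false
    translate ψ q b (atom x) = substAtom ψ q b x
    translate ψ q b (f ∧ g)  = translate ψ q b f and translate ψ q b g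
    translate ψ q b (f ∨ g)  = or (translate ψ q b f) (translate ψ q b g)

    transition : (Q → CTL± a) → Q → Bool → CTL± a
    transition ψ q b = select id (λ σ → translate ψ q b (δ q σ))

    -- By monotonicity the transition formula is equivalent to Y ∨ (X ∧ ◇q) or
    -- X ∧ (Y ∨ □q), where Y and X arise by replacing the atoms of q itself by
    -- false and true.
    solve : Kind → (X Y : CTL± a) → CTL± a
    solve transient   X Y = Y
    solve existential X Y = EU X Y
    solve universal   X Y = neg (EU (neg Y) (neg X))

    build : (Q → CTL± a) → Q → CTL± a
    build ψ q = solve (kind (comp q)) (transition ψ q true) (transition ψ q false)

    module _ {ψ ψ′ : Q → CTL± a} (q : Q) (b : Bool) where

      literal-cong : ∀ x → ψ (state x) ≡ ψ′ (state x) → literal ψ x ≡ literal ψ′ x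
      literal-cong (◇ k q) = cong (D k)
      literal-cong (□ k q) = cong (λ φ → neg (D k (neg φ)))

      translate-cong : ∀ f → (∀ x → x ∈ᴸ atoms f → state x ≢ q → ψ (state x) ≡ ψ′ (state x)) →
                       translate ψ q b f ≡ translate ψ′ q b f
      translate-cong ⊤        e = refl
      translate-cong ⊥        e = refl
      translate-cong (atom x) e with state x Fin.≟ q
      ... | yes _  = refl
      ... | no neq = literal-cong x (e x (here refl) neq)
      translate-cong (f ∧ g)  e = cong₂ _and_ (translate-cong f (λ x m → e x (∈-++⁺ˡ m)))
                                              (translate-cong g (λ x m → e x (∈-++⁺ʳ (atoms f) m)))
      translate-cong (f ∨ g)  e = cong₂ or (translate-cong f (λ x m → e x (∈-++⁺ˡ m)))
                                           (translate-cong g (λ x m → e x (∈-++⁺ʳ (atoms f) m)))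

      -- Atoms of `q` itself have become constants, and linearity puts every other atom strictly
      -- below `q`.
      transition-cong : (∀ q′ → q′ ≺ q → ψ q′ ≡ ψ′ q′) → transition ψ q b ≡ transition ψ′ q b
      transition-cong e = select-cong id λ σ → translate-cong (δ q σ) λ x m neq →
        [ e (state x) , (λ eq → ⊥-elim (neq eq)) ]′ (below-or-equal q σ x m)

    -- Recursion along the component order, done by rounds over all states at once. The starting
    -- formula is arbitrary because it gets overwritten.
    iterate : ℕ → Q → CTL± a
    iterate zero    = λ _ → constant true
    iterate (suc n) = build (iterate n)

    -- A state of component number `c` is settled after `c + 1` rounds, since `build` consults only
    -- smaller components. Hence `#components` rounds settle all states.
    iterate-stable : ∀ n q → toℕ (comp q) < n → iterate n q ≡ iterate (suc n) q
    iterate-stable (suc n) q (s≤s q≤n) = cong₂ (solve (kind (comp q)))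
      (transition-cong q true lower) (transition-cong q false lower)
      where
      lower : ∀ q′ → q′ ≺ q → iterate n q′ ≡ iterate (suc n) q′
      lower q′ lt = iterate-stable n q′ (ℕ.<-≤-trans lt q≤n)

    formula : Q → CTL± a
    formula = iterate #components

    formula-unfold : ∀ q → formula q ≡ build formula q
    formula-unfold q = iterate-stable #components q (Fin.toℕ<n (comp q))

    module _ (t : ΣTree a) where
      open ΣTree t using (Dom; #children; label)

      infix 4 _⊩_
      _⊩_ : Dom → CTL± a → Set
      _⊩_ = _⊨_ t

      P : Q → Dom → Set
      P q v = v ⊩ formula q

      open Semantics t δ F _≺_ P

      ⊩-true : ∀ {v} → v ⊩ constant true
      ⊩-true {v} with em {v ⊩ var p₀}
      ... | yes p = inj₁ p
      ... | no ¬p = inj₂ ¬p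

      ⊩-literal : ∀ v x → v ⊩ literal formula x ⇔ Holds (λ q i → P q (v · i)) x
      ⊩-literal v (◇ k q) = mk⇔ id id
      ⊩-literal v (□ k q) = mk⇔ (from e) (to e)
        where e = AllBut⇔¬AtLeast k (λ i → P q (v · i))

      ⊩-translate : ∀ v q b f → v ⊩ translate formula q b f ⇔ Satisfies (λ x → v ⊩ substAtom formula q b x) f
      ⊩-translate v q b ⊤        = mk⇔ (λ _ → tt) (λ _ → ⊩-true)
      ⊩-translate v q b ⊥        = mk⇔ (λ ¬true → ¬true ⊩-true) (λ ())
      ⊩-translate v q b (atom x) = mk⇔ id id
      ⊩-translate v q b (f ∧ g)  = mk⇔
        (λ h → Product.map (to (⊩-translate v q b f)) (to (⊩-translate v q b g)) (to (⊨-and t v _ _) h))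
        (λ s → from (⊨-and t v _ _) (Product.map (from (⊩-translate v q b f)) (from (⊩-translate v q b g)) s))
      ⊩-translate v q b (f ∨ g)  = mk⇔
        (Sum.map (to (⊩-translate v q b f)) (to (⊩-translate v q b g)))
        (Sum.map (from (⊩-translate v q b f)) (from (⊩-translate v q b g)))

      module _ (q : Q) (Z : Dom → Set) (v : Dom) where

        OwnAtom : (Atom Q → Set) → Set
        OwnAtom R = ∀ x → x ∈ᴸ atoms (δ q (label v)) → state x ≡ q → R x

        -- Atoms of smaller states agree on both sides, so only the atoms of `q` have to be compared
        -- with the constant that replaced them.
        transition⇒Local : ∀ b → OwnAtom (λ x → v ⊩ constant b → Holds (Mix q Z v) x) →
                           v ⊩ transition formula q b → Local q Z v
        transition⇒Local b own h = Satisfies-map (δ q (label v)) atomwise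
          (to (⊩-translate v q b (δ q (label v))) (to (⊨-select-label t v _) h))
          where
          atomwise : ∀ x → x ∈ᴸ atoms (δ q (label v)) → v ⊩ substAtom formula q b x → Holds (Mix q Z v) x
          atomwise x m h with state x Fin.≟ q
          ... | yes eq = own x m eq h
          ... | no neq with below-or-equal q _ x m
          ...   | inj₁ lt = Holds-map x (λ i p → inj₁ (lt , p)) (to (⊩-literal v x) h)
          ...   | inj₂ eq = ⊥-elim (neq eq)

        Local⇒transition : ∀ b → OwnAtom (λ x → Holds (Mix q Z v) x → v ⊩ constant b) →
                           Local q Z v → v ⊩ transition formula q b
        Local⇒transition b own s = from (⊨-select-label t v _) (from (⊩-translate v q b (δ q (label v)))
          (Satisfies-map (δ q (label v)) atomwise s))
          where
          atomwise : ∀ x → x ∈ᴸ atoms (δ q (label v)) → Holds (Mix q Z v) x → v ⊩ substAtom formula q b x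
          atomwise x m h with state x Fin.≟ q
          ... | yes eq = own x m eq h
          ... | no neq = from (⊩-literal v x) (Holds-map x
                  (λ i → [ proj₂ , (λ (eq , _) → ⊥-elim (neq eq)) ]′) h)

        -- With `Local⇒true`, this bounds the monotone operator from below and above, whatever `Z`
        -- is.
        false⇒Local : v ⊩ transition formula q false → Local q Z v
        false⇒Local = transition⇒Local false λ _ _ _ ¬true → ⊥-elim (¬true ⊩-true)

        Local⇒true : Local q Z v → v ⊩ transition formula q true
        Local⇒true = Local⇒transition true λ _ _ _ _ → ⊩-true

        Mix-own : ∀ {i} → Mix q Z v q i → Z (v · i)
        Mix-own (inj₁ (lt , _)) = ⊥-elim (ℕ.<-irrefl refl lt)
        Mix-own (inj₂ (_ , z))  = z

        own-◇ : ∀ x → state x ≡ q → x ≡ ◇ 1 (state x) → Holds (Mix q Z v) x ⇔ (∃[ i ] Z (v · i))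
        own-◇ (◇ k q′) refl refl = mk⇔ (λ h → Product.map₂ Mix-own (to AtLeast-one h))
                                       (λ (i , z) → from (AtLeast-one {R = Mix q Z v q}) (i , inj₂ (refl , z)))

        own-□ : ∀ x → state x ≡ q → x ≡ □ 1 (state x) → Holds (Mix q Z v) x ⇔ (∀ i → Z (v · i))
        own-□ (□ k q′) refl refl = mk⇔ (λ h i → Mix-own (to AllBut-one h i))
                                       (λ z → from AllBut-one (λ i → inj₂ (refl , z i)))

      P-solve : ∀ q {k} → kind (comp q) ≡ k → ∀ v →
                P q v ≡ (v ⊩ solve k (transition formula q true) (transition formula q false))
      P-solve q refl v = cong (v ⊩_) (formula-unfold q)

      -- The own atoms of an existential or universal state share one truth value: whether some
      -- child, or every child, lies in `Z`. Deciding it lets a constant replace them, which gives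
      -- the two-case shape of the operator. A transient state has no own atoms.
      spec-kind : ∀ q k → kind (comp q) ≡ k → Components.IsKind automaton comp k (comp q) → Spec q
      spec-kind q transient eq isTransient = local λ Z v → mk⇔
        (λ p → false⇒Local q Z v (subst id (P-solve q eq v) p))
        (λ s → subst id (sym (P-solve q eq v)) (Local⇒transition q Z v false
          (λ x m e _ → ⊥-elim (isTransient q _ refl x m (cong comp e))) s))
      spec-kind q existential eq isEx = least (proj₁ (polarised q) eq) X Y
        (λ v → subst (_⇔ (∃[ n ] Until t X Y n v)) (sym (P-solve q eq v)) (EU⇔Until t _ _ v)) unfolded
        where
        X Y : Dom → Set
        X v = v ⊩ transition formula q true
        Y v = v ⊩ transition formula q false
        unfolded : ∀ Z v → Local q Z v ⇔ (Y v ⊎ (X v × (∃[ i ] Z (v · i))))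
        unfolded Z v = mk⇔ forth back
          where
          own : ∀ x → x ∈ᴸ atoms (δ q (label v)) → state x ≡ q → Holds (Mix q Z v) x ⇔ (∃[ i ] Z (v · i))
          own x m e = own-◇ q Z v x e (proj₁ (isEx q _ refl) x m (cong comp e))
          forth : Local q Z v → Y v ⊎ (X v × (∃[ i ] Z (v · i)))
          forth s with em {∃[ i ] Z (v · i)}
          ... | yes z = inj₂ (Local⇒true q Z v s , z)
          ... | no ¬z = inj₁ (Local⇒transition q Z v false (λ x m e h → ⊥-elim (¬z (to (own x m e) h))) s)
          back : Y v ⊎ (X v × (∃[ i ] Z (v · i))) → Local q Z v
          back (inj₁ y)       = false⇒Local q Z v y
          back (inj₂ (x , z)) = transition⇒Local q Z v true (λ y m e _ → from (own y m e) z) x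
      spec-kind q universal eq isUn = greatest (proj₂ (polarised q) eq) X Y
        (λ v → subst (_⇔ (¬ (∃[ n ] Until t X Y n v))) (sym (P-solve q eq v))
                 (mk⇔ (_∘ from (EU⇔Until t _ _ v)) (_∘ to (EU⇔Until t _ _ v)))) unfolded
        where
        -- The arguments of the negated until in `solve`, hence the complements and the exchange of
        -- `true` and `false`.
        X Y : Dom → Set
        X v = ¬ (v ⊩ transition formula q false)
        Y v = ¬ (v ⊩ transition formula q true)
        unfolded : ∀ Z v → Local q Z v ⇔ ((¬ Y v) × ((¬ X v) ⊎ (∀ i → Z (v · i))))
        unfolded Z v = mk⇔ forth back
          where
          own : ∀ x → x ∈ᴸ atoms (δ q (label v)) → state x ≡ q → Holds (Mix q Z v) x ⇔ (∀ i → Z (v · i))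
          own x m e = own-□ q Z v x e (proj₁ (isUn q _ refl) x m (cong comp e))
          forth : Local q Z v → (¬ Y v) × ((¬ X v) ⊎ (∀ i → Z (v · i)))
          forth s = (λ y → y (Local⇒true q Z v s)) , choice
            where
            choice : (¬ X v) ⊎ (∀ i → Z (v · i))
            choice with em {∀ i → Z (v · i)}
            ... | yes z = inj₂ z
            ... | no ¬z = inj₁ λ x → x (Local⇒transition q Z v false (λ x m e h → ⊥-elim (¬z (to (own x m e) h))) s)
          back : (¬ Y v) × ((¬ X v) ⊎ (∀ i → Z (v · i))) → Local q Z v
          back (_ , inj₁ ¬x)  = false⇒Local q Z v (stable ¬x)
          back (¬y , inj₂ z)  = transition⇒Local q Z v true (λ x m e _ → from (own x m e) z) (stable ¬y)

      spec : ∀ q → Spec q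
      spec q = spec-kind q (kind (comp q)) refl (isKind (comp q))

      language : ℒ-HTA± A t ⇔ ℒ-CTL± (formula qI) t
      language = Adequacy.adequate t automaton _≺_ (On.wellFounded comp <-wellFounded) below-or-equal P spec

  -- From formulae to linear automata: signed formulae and tables of states.

  -- Transition formulae are positive, so compilation carries a sign and pushes negations down to
  -- the propositions.
  signed : ∀ {a} → Bool → CTL± a → CTL± a
  signed true  φ = φ
  signed false φ = neg φ

  Code : ℕ → ℕ → Set
  Code a n = Subset a → B⁺ (Atom (Fin n))

  _under_ : ∀ {a m n} → Code a m → (Fin m → Fin n) → Code a n
  (f under h) σ = mapB (mapAtom h) (f σ)

  module _ {a : ℕ} where

    record Means {n} (tbl : Vec (CTL± a) n) (f : Code a n) (χ : CTL± a) : Set where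
      constructor interpretation
      field
        meaning : ∀ (t : ΣTree a) v →
          _⊨_ t v χ ⇔ Satisfies (Holds (λ q i → _⊨_ t (v · i) (lookup tbl q))) (f (ΣTree.label t v))
    open Means

    data Entry {n} (tbl : Vec (CTL± a) n) : CTL± a → Set where
      simple : ∀ {χ} f → Means tbl f χ → Entry tbl χ
      until  : ∀ {φ ψ} f g → Means tbl f φ → Means tbl g ψ → Entry tbl (EU φ ψ)
      unless : ∀ {φ ψ} f g → Means tbl f (neg φ) → Means tbl g (neg ψ) → Entry tbl (neg (EU φ ψ))

    -- A linear automaton with one state per formula of the table.  The newest
    -- state is zero, so atoms refer to states of larger or equal index.
    data System : ∀ {n} → Vec (CTL± a) n → Set where
      []  : System []
      _▷_ : ∀ {n} {tbl : Vec (CTL± a) n} {χ} → System tbl → Entry tbl χ → System (χ ∷ tbl)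

    -- The expansions ψ ∨ (φ ∧ EX E(φ U ψ)) and ¬ψ ∧ (¬φ ∨ AX ¬E(φ U ψ)). In the second, `f` and `g`
    -- code the negated arguments.
    untilBody unlessBody : ∀ {n} → Code a n → Code a n → Code a (suc n)
    untilBody  f g σ = (g under suc) σ ∨ ((f under suc) σ ∧ atom (◇ 1 zero))
    unlessBody f g σ = (g under suc) σ ∧ ((f under suc) σ ∨ atom (□ 1 zero))

    body : ∀ {n} {tbl : Vec (CTL± a) n} {χ} → Entry tbl χ → Code a (suc n)
    body (simple f _)     = f under suc
    body (until f g _ _)  = untilBody f g
    body (unless f g _ _) = unlessBody f g

    entryKind : ∀ {n} {tbl : Vec (CTL± a) n} {χ} → Entry tbl χ → Kind
    entryKind (simple _ _)     = transient
    entryKind (until _ _ _ _)  = existential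
    entryKind (unless _ _ _ _) = universal

    systemδ : ∀ {n} {tbl : Vec (CTL± a) n} → System tbl → Fin n → Code a n
    systemδ (S ▷ e) zero    = body e
    systemδ (S ▷ e) (suc q) = systemδ S q under suc

    systemKind : ∀ {n} {tbl : Vec (CTL± a) n} → System tbl → Fin n → Kind
    systemKind (S ▷ e) zero    = entryKind e
    systemKind (S ▷ e) (suc q) = systemKind S q

    accepts : Kind → Bool
    accepts universal = inside
    accepts _         = outside

    systemF : ∀ {n} {tbl : Vec (CTL± a) n} → System tbl → Subset n
    systemF []      = []
    systemF (S ▷ e) = accepts (entryKind e) ∷ systemF S

    systemF-lookup : ∀ {n} {tbl : Vec (CTL± a) n} (S : System tbl) q →
                     lookup (systemF S) q ≡ accepts (systemKind S q)
    systemF-lookup (S ▷ e) zero    = refl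
    systemF-lookup (S ▷ e) (suc q) = systemF-lookup S q

    existential-∉ : ∀ {n} {tbl : Vec (CTL± a) n} (S : System tbl) q → systemKind S q ≡ existential → q ∉ systemF S
    existential-∉ S q eq m
      with () ← trans (sym (trans (systemF-lookup S q) (cong accepts eq))) ([]=⇒lookup m)

    universal-∈ : ∀ {n} {tbl : Vec (CTL± a) n} (S : System tbl) q → systemKind S q ≡ universal → q ∈ systemF S
    universal-∈ S q eq = lookup⇒[]= q _ (trans (systemF-lookup S q) (cong accepts eq))

    OwnAtom : ∀ {Q : Set} → Kind → Q → Atom Q → Set
    OwnAtom transient   q x = Fin 0
    OwnAtom existential q x = x ≡ ◇ 1 q
    OwnAtom universal   q x = x ≡ □ 1 q

    AtomOK : ∀ {n} → Kind → Fin n → Atom (Fin n) → Set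
    AtomOK k q x = q Fin.< state x ⊎ OwnAtom k q x

    OwnAtom-state : ∀ {Q : Set} k {q : Q} {x} → OwnAtom k q x → state x ≡ q
    OwnAtom-state existential refl = refl
    OwnAtom-state universal   refl = refl

    OwnAtom-suc : ∀ {n} k {q : Fin n} {x} → OwnAtom k q x → OwnAtom k (suc q) (mapAtom suc x)
    OwnAtom-suc existential refl = refl
    OwnAtom-suc universal   refl = refl

    under-suc-ok : ∀ {n} k (f : Code a n) σ → All (AtomOK k zero) (atoms ((f under suc) σ))
    under-suc-ok k f σ = All-atoms-mapB (mapAtom suc) (f σ) (All.universal
      (λ x → inj₁ (subst (λ q → 0 < toℕ q) (sym (state-mapAtom suc x)) (s≤s z≤n))) _)

    system-ok : ∀ {n} {tbl : Vec (CTL± a) n} (S : System tbl) q σ →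
                All (AtomOK (systemKind S q) q) (atoms (systemδ S q σ))
    system-ok (S ▷ simple f _)     zero σ = under-suc-ok transient f σ
    system-ok (S ▷ until f g _ _)  zero σ =
      All.++⁺ (under-suc-ok existential g σ) (All.++⁺ (under-suc-ok existential f σ) (inj₂ refl ∷ []))
    system-ok (S ▷ unless f g _ _) zero σ =
      All.++⁺ (under-suc-ok universal g σ) (All.++⁺ (under-suc-ok universal f σ) (inj₂ refl ∷ []))
    system-ok (S ▷ e) (suc q) σ = All-atoms-mapB (mapAtom suc) (systemδ S q σ)
      (All.map (λ {x} → Sum.map (λ lt → subst (λ q′ → suc (toℕ q) < toℕ q′) (sym (state-mapAtom suc x)) (s≤s lt))
                                (OwnAtom-suc (systemKind S q)))
               (system-ok S q σ))

    -- Atoms point to larger or equal indices, whereas components may not increase along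
    -- transitions; numbering components by `opposite` reconciles the two.
    opposite-antitone : ∀ {n} {i j : Fin n} → i Fin.≤ j → opposite j Fin.≤ opposite i
    opposite-antitone {n} {i} {j} le rewrite Fin.opposite-prop i | Fin.opposite-prop j = ℕ.∸-monoʳ-≤ n (s≤s le)

    opposite-injective : ∀ {n} → Injective _≡_ _≡_ (opposite {n})
    opposite-injective {x = i} {j} eq =
      trans (sym (Fin.opposite-involutive i)) (trans (cong opposite eq) (Fin.opposite-involutive j))

    -- The linear automaton of a table.

    module _ {n} {tbl : Vec (CTL± a) n} (S : System tbl) (q₀ : Fin n) where

      systemAutomaton : Automaton a
      systemAutomaton = record { #Q = n ; δ = systemδ S ; qI = q₀ ; F = systemF S }

      ok : ∀ q σ x → x ∈ᴸ atoms (systemδ S q σ) → AtomOK (systemKind S q) q x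
      ok q σ x = All.lookup (system-ok S q σ)

      below-or-equal : ∀ q σ x → x ∈ᴸ atoms (systemδ S q σ) → q Fin.< state x ⊎ state x ≡ q
      below-or-equal q σ x m = Sum.map₂ (OwnAtom-state (systemKind S q)) (ok q σ x m)

      own : ∀ q σ x → x ∈ᴸ atoms (systemδ S q σ) → opposite (state x) ≡ opposite q →
            OwnAtom (systemKind S q) q x
      own q σ x m eq with ok q σ x m
      ... | inj₁ lt = ⊥-elim (ℕ.<-irrefl (cong toℕ (sym (opposite-injective eq))) lt)
      ... | inj₂ o  = o

      -- All own atoms of a state are one and the same atom, so any two of them in a clause
      -- coincide.
      isKindOf : ∀ q → Components.IsKind systemAutomaton opposite (systemKind S q) (opposite q)
      isKindOf q with systemKind S q | own q
      ... | transient   | own-q = λ q′ σ eq x m e → case opposite-injective eq of λ where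
              refl → case own-q σ x m e of λ ()
      ... | existential | own-q = λ q′ σ eq → case opposite-injective eq of λ where
              refl → (λ x m e → trans (own-q σ x m e) (cong (◇ 1) (sym (opposite-injective e))))
                   , (λ c c∈ x y x∈ y∈ ex ey →
                        trans (own-q σ x (dnf-atoms (systemδ S q σ) c∈ x∈) ex)
                              (sym (own-q σ y (dnf-atoms (systemδ S q σ) c∈ y∈) ey)))
      ... | universal   | own-q = λ q′ σ eq → case opposite-injective eq of λ where
              refl → (λ x m e → trans (own-q σ x m e) (cong (□ 1) (sym (opposite-injective e))))
                   , (λ c c∈ x y x∈ y∈ ex ey →
                        trans (own-q σ x (cnf-atoms (systemδ S q σ) c∈ x∈) ex)
                              (sym (own-q σ y (cnf-atoms (systemδ S q σ) c∈ y∈) ey)))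

      systemHTA : HTA± a
      systemHTA = record
        { automaton = systemAutomaton
        ; hesitant  = record
          { #components = n
          ; comp        = opposite
          ; nonempty    = λ i → opposite i , Fin.opposite-involutive i
          ; ordered     = λ q σ x m → opposite-antitone
              ([ ℕ.<⇒≤ , (λ eq → ℕ.≤-reflexive (cong toℕ (sym eq))) ]′ (below-or-equal q σ x m))
          ; kind        = systemKind S ∘ opposite
          ; isKind      = λ i → subst (Components.IsKind systemAutomaton opposite (systemKind S (opposite i)))
                                      (Fin.opposite-involutive i) (isKindOf (opposite i))
          }
        ; polarised = λ q → (λ eq → existential-∉ S q (trans (sym (cong (systemKind S) (Fin.opposite-involutive q))) eq))
                          , (λ eq → universal-∈ S q (trans (sym (cong (systemKind S) (Fin.opposite-involutive q))) eq))
        }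

    -- The language of a table's automaton.

    module _ (t : ΣTree a) where
      open ΣTree t using (Dom; label; #children)

      At : ∀ {n} → Vec (CTL± a) n → (v : Dom) → Fin n → Fin (#children v) → Set
      At tbl v q i = _⊨_ t (v · i) (lookup tbl q)

      module _ {n m : ℕ} {tbl : Vec (CTL± a) n} {v : Dom} {h : Fin n → Fin m}
               {R : Fin m → Fin (#children v) → Set} (e : ∀ q i → At tbl v q i ⇔ R (h q) i) where

        -- The relation `R` stays free outside the image of `h`, so that a new state can be read as
        -- an arbitrary set.
        under⇔ : ∀ {χ} f → Means tbl f χ → Satisfies (Holds R) ((f under h) (label v)) ⇔ _⊨_ t v χ
        under⇔ f M = mk⇔ (from (meaning M t v) ∘ from s) (to s ∘ to (meaning M t v))
          where s = Satisfies-mapB (mapAtom h) (f (label v)) (Holds-mapAtom h e)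

      module _ {n : ℕ} {tbl : Vec (CTL± a) n} {v : Dom}
               {R : Fin (suc n) → Fin (#children v) → Set} (e : ∀ q i → At tbl v q i ⇔ R (suc q) i) where

        untilBody⇔ : ∀ {φ ψ} f g → Means tbl f φ → Means tbl g ψ →
          Satisfies (Holds R) (untilBody f g (label v)) ⇔ (_⊨_ t v ψ ⊎ (_⊨_ t v φ × (∃[ i ] R zero i)))
        untilBody⇔ f g Mf Mg = mk⇔
          (Sum.map (to (under⇔ e g Mg)) (Product.map (to (under⇔ e f Mf)) (to AtLeast-one)))
          (Sum.map (from (under⇔ e g Mg)) (Product.map (from (under⇔ e f Mf)) (from AtLeast-one)))

        unlessBody⇔ : ∀ {φ ψ} f g → Means tbl f (neg φ) → Means tbl g (neg ψ) →
          Satisfies (Holds R) (unlessBody f g (label v)) ⇔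
          ((¬ (_⊨_ t v ψ)) × ((¬ (_⊨_ t v φ)) ⊎ (∀ i → R zero i)))
        unlessBody⇔ f g Mf Mg = mk⇔
          (Product.map (to (under⇔ e g Mg)) (Sum.map (to (under⇔ e f Mf)) (to AllBut-one)))
          (Product.map (from (under⇔ e g Mg)) (Sum.map (from (under⇔ e f Mf)) (from AllBut-one)))

      P : ∀ {n} → Vec (CTL± a) n → Fin n → Dom → Set
      P tbl q v = _⊨_ t v (lookup tbl q)

      module Sem {n} {tbl : Vec (CTL± a) n} (S : System tbl) =
        Semantics t (systemδ S) (systemF S) Fin._>_ (P tbl)

      Mix-zero : ∀ {n} {tbl : Vec (CTL± a) n} {χ} (S : System tbl) (e : Entry tbl χ) Z v q i →
                 At tbl v q i ⇔ Sem.Mix (S ▷ e) zero Z v (suc q) i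
      Mix-zero S e Z v q i = mk⇔ (λ p → inj₁ (s≤s z≤n , p)) [ proj₂ , (λ ()) ]′

      Mix-own : ∀ {n} {tbl : Vec (CTL± a) n} (S : System tbl) q Z v i → Sem.Mix S q Z v q i ⇔ Z (v · i)
      Mix-own S q Z v i = mk⇔ [ (λ (lt , _) → ⊥-elim (ℕ.<-irrefl refl lt)) , proj₂ ]′ (λ z → inj₂ (refl , z))

      -- Older states never refer to the newest one, so adding an entry leaves their operators
      -- unchanged.
      Local-suc : ∀ {n} {tbl : Vec (CTL± a) n} {χ} (S : System tbl) (e : Entry tbl χ) q Z v →
                  Sem.Local S q Z v ⇔ Sem.Local (S ▷ e) (suc q) Z v
      Local-suc S e q Z v = Satisfies-mapB (mapAtom suc) (systemδ S q (label v)) (Holds-mapAtom suc λ q′ i → mk⇔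
        (Sum.map (Product.map₁ s≤s) (Product.map₁ (cong suc)))
        (Sum.map (Product.map₁ ℕ.≤-pred) (Product.map₁ Fin.suc-injective)))

      spec-suc : ∀ {n} {tbl : Vec (CTL± a) n} {χ} (S : System tbl) (e : Entry tbl χ) {q} →
                 Sem.Spec S q → Sem.Spec (S ▷ e) (suc q)
      spec-suc S e (Sem.local l) = Sem.local λ Z v →
        mk⇔ (to (Local-suc S e _ Z v) ∘ to (l Z v)) (from (l Z v) ∘ from (Local-suc S e _ Z v))
      spec-suc S e (Sem.least ∉F X Y p l) = Sem.least (λ { (there m) → ∉F m }) X Y p λ Z v →
        mk⇔ (to (l Z v) ∘ from (Local-suc S e _ Z v)) (to (Local-suc S e _ Z v) ∘ from (l Z v))
      spec-suc S e (Sem.greatest ∈F X Y p l) = Sem.greatest (there ∈F) X Y p λ Z v →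
        mk⇔ (to (l Z v) ∘ from (Local-suc S e _ Z v)) (to (Local-suc S e _ Z v) ∘ from (l Z v))

      system-spec : ∀ {n} {tbl : Vec (CTL± a) n} (S : System tbl) q → Sem.Spec S q
      system-spec (S ▷ e@(simple f M)) zero = Sem.local λ Z v →
        mk⇔ (from (under⇔ (Mix-zero S e Z v) f M)) (to (under⇔ (Mix-zero S e Z v) f M))
      system-spec (S ▷ e@(until {φ} {ψ} f g Mf Mg)) zero =
        Sem.least (λ ()) (λ v → _⊨_ t v φ) (λ v → _⊨_ t v ψ) (EU⇔Until t φ ψ) λ Z v →
          let u = untilBody⇔ (Mix-zero S e Z v) f g Mf Mg
              o = Mix-own (S ▷ e) zero Z v
          in mk⇔ (Sum.map₂ (Product.map₂ (Product.map₂ (to (o _)))) ∘ to u)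
                 (from u ∘ Sum.map₂ (Product.map₂ (Product.map₂ (from (o _)))))
      system-spec (S ▷ e@(unless {φ} {ψ} f g Mf Mg)) zero =
        Sem.greatest here (λ v → _⊨_ t v φ) (λ v → _⊨_ t v ψ)
          (λ v → mk⇔ (_∘ from (EU⇔Until t φ ψ v)) (_∘ to (EU⇔Until t φ ψ v))) λ Z v →
          let u = unlessBody⇔ (Mix-zero S e Z v) f g Mf Mg
              o = Mix-own (S ▷ e) zero Z v
          in mk⇔ (Product.map₂ (Sum.map₂ (λ all i → to (o i) (all i))) ∘ to u)
                 (from u ∘ Product.map₂ (Sum.map₂ (λ all i → from (o i) (all i))))
      system-spec (S ▷ e) (suc q) = spec-suc S e (system-spec S q)

      system-language : ∀ {n} {tbl : Vec (CTL± a) n} (S : System tbl) q →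
                        ℒ-HTA± (systemHTA S q) t ⇔ ℒ-CTL± (lookup tbl q) t
      system-language {tbl = tbl} S q = Adequacy.adequate t (systemAutomaton S q) Fin._>_ >-wellFounded
        (below-or-equal S q) (P tbl) (system-spec S)

    -- Compilation of formulae.

    -- Compilation may enlarge the table; `embed` tracks where earlier formulae have moved, so that
    -- codes made before remain usable after renaming.
    record Compiled {n} (tbl : Vec (CTL± a) n) (χ : CTL± a) : Set where
      constructor compiled
      field
        {size}    : ℕ
        {table}   : Vec (CTL± a) size
        system    : System table
        embed     : Fin n → Fin size
        preserved : ∀ q → lookup table (embed q) ≡ lookup tbl q
        code      : Code a size
        means     : Means table code χ

    Means-under : ∀ {n m} {tbl : Vec (CTL± a) n} {tbl′ : Vec (CTL± a) m} {χ} (h : Fin n → Fin m) →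
                  (∀ q → lookup tbl′ (h q) ≡ lookup tbl q) → ∀ f → Means tbl f χ → Means tbl′ (f under h) χ
    Means-under {tbl = tbl} {tbl′} h pres f M = interpretation λ t v → mk⇔ (from (u t v)) (to (u t v))
      where
      u = λ t v → under⇔ t {tbl = tbl} {v} {h} {At t tbl′ v}
            (λ q i → subst (λ χ → At t tbl v q i ⇔ _⊨_ t (v · i) χ) (sym (pres q)) (mk⇔ id id)) f M

    Means-⇔ : ∀ {n} {tbl : Vec (CTL± a) n} {χ χ′} {f : Code a n} → (∀ (t : ΣTree a) v → _⊨_ t v χ ⇔ _⊨_ t v χ′) →
              Means tbl f χ → Means tbl f χ′
    Means-⇔ e M = interpretation λ t v → mk⇔ (to (meaning M t v) ∘ from (e t v)) (to (e t v) ∘ from (meaning M t v))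

    compiled-⇔ : ∀ {n} {tbl : Vec (CTL± a) n} {χ χ′} → (∀ (t : ΣTree a) v → _⊨_ t v χ ⇔ _⊨_ t v χ′) →
                 Compiled tbl χ → Compiled tbl χ′
    compiled-⇔ e (compiled S h pres f M) = compiled S h pres f (Means-⇔ e M)

    record Compiled₂ {n} (tbl : Vec (CTL± a) n) (φ ψ : CTL± a) : Set where
      constructor compiled₂
      field
        {size}       : ℕ
        {table}      : Vec (CTL± a) size
        system       : System table
        embed        : Fin n → Fin size
        preserved    : ∀ q → lookup table (embed q) ≡ lookup tbl q
        code₁ code₂  : Code a size
        means₁       : Means table code₁ φ
        means₂       : Means table code₂ ψ

    -- The second formula is compiled on top of the table produced by the first, which is not known
    -- in advance; hence the polymorphic argument.
    both : ∀ {n} {tbl : Vec (CTL± a) n} {φ ψ} → Compiled tbl φ →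
           (∀ {m} {tbl′ : Vec (CTL± a) m} → System tbl′ → Compiled tbl′ ψ) → Compiled₂ tbl φ ψ
    both (compiled S₁ h₁ pres₁ f₁ M₁) next with next S₁
    ... | compiled S₂ h₂ pres₂ f₂ M₂ =
      compiled₂ S₂ (h₂ ∘ h₁) (λ q → trans (pres₂ (h₁ q)) (pres₁ q)) (f₁ under h₂) f₂ (Means-under h₂ pres₂ f₁ M₁) M₂

    -- The argument becomes a new transient state. A negated `D k` is a `□ k` over a state for the
    -- negated argument, by the duality of the counting modalities.
    compileD : ∀ {n} {tbl : Vec (CTL± a) n} b k {φ} → Compiled tbl (signed b φ) → Compiled tbl (signed b (D k φ))
    compileD true  k (compiled S h pres f M) =
      compiled (S ▷ simple f M) (suc ∘ h) pres (λ _ → atom (◇ k zero)) (interpretation λ t v → mk⇔ id id)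
    compileD false k {φ} (compiled S h pres f M) =
      compiled (S ▷ simple f M) (suc ∘ h) pres (λ _ → atom (□ k zero)) (interpretation λ t v →
        let e = AllBut⇔¬AtLeast k (λ i → ¬ (_⊨_ t (v · i) φ))
        in mk⇔ (λ ¬d → from e (¬d ∘ Product.map₂ (Product.map₂ λ p i → stable (p i))))
               (λ s → to e s ∘ Product.map₂ (Product.map₂ λ p i ¬p → ¬p (p i))))

    D₁⇔EX : ∀ b φ (t : ΣTree a) v → _⊨_ t v (signed b (D 1 φ)) ⇔ _⊨_ t v (signed b (EX φ))
    D₁⇔EX true  φ t v = AtLeast-one
    D₁⇔EX false φ t v = mk⇔ (_∘ from AtLeast-one) (_∘ to AtLeast-one)

    varCode : ∀ {n} → Bool → Fin a → Code a n
    varCode true  p σ = if lookup σ p then ⊤ else ⊥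
    varCode false p σ = if lookup σ p then ⊥ else ⊤

    varCode-means : ∀ {n} {tbl : Vec (CTL± a) n} b p (t : ΣTree a) v → _⊨_ t v (signed b (var p)) ⇔
                    Satisfies (Holds (λ q i → _⊨_ t (v · i) (lookup tbl q))) (varCode b p (ΣTree.label t v))
    varCode-means true  p t v with lookup (ΣTree.label t v) p in eq
    ... | true  = mk⇔ (λ _ → tt) (λ _ → lookup⇒[]= p _ eq)
    ... | false = mk⇔ (λ m → case trans (sym eq) ([]=⇒lookup m) of λ ()) (λ ())
    varCode-means false p t v with lookup (ΣTree.label t v) p in eq
    ... | true  = mk⇔ (λ ¬m → ¬m (lookup⇒[]= p _ eq)) (λ ())
    ... | false = mk⇔ (λ _ → tt) (λ _ m → case trans (sym eq) ([]=⇒lookup m) of λ ())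

    compile : ∀ b φ {n} {tbl : Vec (CTL± a) n} → System tbl → Compiled tbl (signed b φ)
    compile true  (var p) {tbl = tbl} S =
      compiled S id (λ _ → refl) (varCode true p) (interpretation (varCode-means {tbl = tbl} true p))
    compile false (var p) {tbl = tbl} S =
      compiled S id (λ _ → refl) (varCode false p) (interpretation (varCode-means {tbl = tbl} false p))
    compile true  (neg φ) S = compile false φ S
    compile false (neg φ) S = compiled-⇔ (λ t v → mk⇔ (λ p ¬p → ¬p p) stable) (compile true φ S)
    compile true  (or φ ψ) S with both (compile true φ S) (compile true ψ)
    ... | compiled₂ S′ h pres f g Mf Mg = compiled S′ h pres (λ σ → f σ ∨ g σ) (interpretation λ t v →
            mk⇔ (Sum.map (to (meaning Mf t v)) (to (meaning Mg t v))) (Sum.map (from (meaning Mf t v)) (from (meaning Mg t v))))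
    compile false (or φ ψ) S with both (compile false φ S) (compile false ψ)
    ... | compiled₂ S′ h pres f g Mf Mg = compiled S′ h pres (λ σ → f σ ∧ g σ) (interpretation λ t v →
            mk⇔ (λ ¬p → to (meaning Mf t v) (¬p ∘ inj₁) , to (meaning Mg t v) (¬p ∘ inj₂))
                (λ (p , q) → [ from (meaning Mf t v) p , from (meaning Mg t v) q ]′))
    compile b (D k φ) S = compileD b k (compile b φ S)
    compile b (EX φ)  S = compiled-⇔ (D₁⇔EX b φ) (compileD b 1 (compile b φ S))
    compile true  (EU φ ψ) S with both (compile true φ S) (compile true ψ)
    ... | compiled₂ {table = table} S′ h pres f g Mf Mg =
      -- The current node uses the expansion directly; the new state, with that same transition
      -- formula, is entered at the children.
      compiled (S′ ▷ until f g Mf Mg) (suc ∘ h) pres (untilBody f g) (interpretation λ t v →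
        let u = untilBody⇔ t {tbl = table} {v} {At t (EU φ ψ ∷ table) v} (λ q i → mk⇔ id id) f g Mf Mg
            w = Until-unfold t (λ v → _⊨_ t v φ) (λ v → _⊨_ t v ψ) v
            e = EU⇔Until t φ ψ
        in mk⇔ (from u ∘ Sum.map₂ (Product.map₂ (Product.map₂ (from (e _)))) ∘ to w ∘ to (e v))
               (from (e v) ∘ from w ∘ Sum.map₂ (Product.map₂ (Product.map₂ (to (e _)))) ∘ to u))
    compile false (EU φ ψ) S with both (compile false φ S) (compile false ψ)
    ... | compiled₂ {table = table} S′ h pres f g Mf Mg =
      compiled (S′ ▷ unless f g Mf Mg) (suc ∘ h) pres (unlessBody f g) (interpretation λ t v →
        let u = unlessBody⇔ t {tbl = table} {v} {At t (neg (EU φ ψ) ∷ table) v} (λ q i → mk⇔ id id) f g Mf Mg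
            w = ¬Until-unfold t (λ v → _⊨_ t v φ) (λ v → _⊨_ t v ψ) v
            e = EU⇔Until t φ ψ
        in mk⇔ (λ ¬p → from u (Product.map₂ (Sum.map₂ λ all i → all i ∘ to (e _)) (to w (¬p ∘ from (e v)))))
               (λ s → from w (Product.map₂ (Sum.map₂ λ all i → all i ∘ from (e _)) (to u s)) ∘ to (e v)))

    -- Compilation yields a transition formula rather than a state, so one further transient state
    -- is added as initial state.
    toAutomaton : ∀ φ → ∃[ A ] (Linear A × (ℒ-HTA± A ≐ ℒ-CTL± φ))
    toAutomaton φ with compile true φ []
    ... | compiled S _ _ f M = systemHTA S′ zero , opposite-injective
                             , (λ {t} → to (system-language t S′ zero)) , (λ {t} → from (system-language t S′ zero))
      where S′ = S ▷ simple f M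

theorem5p5 : ExcludedMiddle 0ℓ → (a : ℕ) → .{{_ : NonZero a}} →
    ((A : HTA± a) → Linear A → ∃[ φ ] (ℒ-HTA± A ≐ ℒ-CTL± φ))
    × ((φ : CTL± a) → ∃[ A ] (Linear A × (ℒ-HTA± A ≐ ℒ-CTL± φ)))
theorem5p5 em zero    = ⊥-elim (≢-nonZero⁻¹ 0 refl)
theorem5p5 em (suc a) = fromAutomaton , Classical.toAutomaton em
  where
  fromAutomaton : (A : HTA± (suc a)) → Linear A → ∃[ φ ] (ℒ-HTA± A ≐ ℒ-CTL± φ)
  fromAutomaton A linear = formula (HTA±.qI A) , (λ {t} → to (language t)) , (λ {t} → from (language t))
    -- `NonZero` guarantees a proposition; the first one, `zero`, is used to form the truth
    -- constants.
    where open Classical.FromAutomaton em A linear zero
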